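{- Let $G$ be a $2$-connected chordal bipartite graph of order $n\ge 4$ and size $m$. Then $$m \ge \begin{cases} \frac{3}{2}n-\frac{3}{2} & \text{if } n \text{ is odd},\\ \frac{3}{2}n-2 & \text{if } n \text{ is even}.\end{cases}$$ Moreover, the bounds are tight: for every integer $n\ge 4$ there exists a $2$-connected chordal bipartite graph of order $n$ whose size equals the bound above for that $n$.
   Context: All graphs are finite and simple. The order of a graph is its number of vertices and the size is its number of edges. A graph is bipartite if its vertex set can be partitioned into two independent sets. A chord of a cycle $C$ is an edge not in $E(C)$ both of whose end-vertices lie on $C$. A bipartite graph is called chordal bipartite if every cycle of length at least six has a chord. A vertex cut of $G$ is a set $S\subseteq V(G)$ such that $G-S$ is disconnected. The connectivity $\kappa(G)$ is the minimum size of a vertex cut if $G$ is not complete, and $|V(G)|-1$ if $G$ is complete. $G$ is $k$-connected if $\kappa(G)\ge k$. -}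

module Defs where

open import Data.Fin using (Fin; toℕ; _<_)
open import Data.Fin.Properties using (_<?_)
open import Data.Fin.Subset using (Subset; _∈_; _∉_; ∁; ∣_∣)
open import Data.Integer using (+_)
open import Data.List using (List; allFin; cartesianProduct; filter; length)
open import Data.Nat using (ℕ; suc; _∸_; _≤_; parity)
open import Data.Parity using (0ℙ; 1ℙ)
open import Data.Product using (∃; ∃₂; _×_; _,_)
open import Data.Rational.Unnormalised using (ℚᵘ; _/_; _*_; _-_)
open import Data.Sum using (_⊎_)
open import Function.Definitions using (Injective)
open import Level using (0ℓ)
open import Relation.Binary using (Rel; Decidable; Symmetric; Irreflexive)
open import Relation.Binary.Construct.Closure.ReflexiveTransitive using (Star)
open import Relation.Binary.PropositionalEquality using (_≡_; _≢_)
open import Relation.Nullary using (¬_)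
open import Relation.Nullary.Decidable using (_×-dec_)

record Graph (n : ℕ) : Set₁ where
  field
    Adj    : Rel (Fin n) 0ℓ
    adj?   : Decidable Adj
    sym    : Symmetric Adj
    irrefl : Irreflexive _≡_ Adj

open Graph public

-- Each edge is listed once, with its smaller end-vertex first.
edges : ∀ {n} → Graph n → List (Fin n × Fin n)
edges {n} G =
  filter (λ (u , v) → (u <? v) ×-dec adj? G u v)
         (cartesianProduct (allFin n) (allFin n))

size : ∀ {n} → Graph n → ℕ
size G = length (edges G)

Independent : ∀ {n} → Graph n → Subset n → Set
Independent G X = ∀ {u v} → u ∈ X → v ∈ X → ¬ Adj G u v

Bipartite : ∀ {n} → Graph n → Set
Bipartite {n} G = ∃ λ (X : Subset n) → Independent G X × Independent G (∁ X)

-- j is the cyclic successor of i, i.e. toℕ j ≡ toℕ i + 1 modulo k.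
Next : ∀ {k} → Fin k → Fin k → Set
Next {k} i j = (toℕ j ≡ suc (toℕ i)) ⊎ (suc (toℕ i) ≡ k × toℕ j ≡ 0)

record Cycle {n} (G : Graph n) : Set where
  field
    len       : ℕ
    3≤len     : 3 ≤ len
    vertex    : Fin len → Fin n
    injective : Injective _≡_ _≡_ vertex
    adjacent  : ∀ {i j} → Next i j → Adj G (vertex i) (vertex j)

open Cycle public

OnCycle : ∀ {n} {G : Graph n} → Cycle G → Fin n → Set
OnCycle C v = ∃ λ i → vertex C i ≡ v

CycleEdge : ∀ {n} {G : Graph n} → Cycle G → Fin n → Fin n → Set
CycleEdge C u v =
  ∃₂ λ i j → (Next i j ⊎ Next j i) × vertex C i ≡ u × vertex C j ≡ v

Chord : ∀ {n} {G : Graph n} → Cycle G → Fin n → Fin n → Set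
Chord {G = G} C u v =
  Adj G u v × ¬ CycleEdge C u v × OnCycle C u × OnCycle C v

ChordalBipartite : ∀ {n} → Graph n → Set
ChordalBipartite G =
  Bipartite G × (∀ (C : Cycle G) → 6 ≤ len C → ∃₂ λ u v → Chord C u v)

-- Adjacency in G − S, with the vertices of S kept as isolated points of Fin n.
AdjWithout : ∀ {n} → Graph n → Subset n → Rel (Fin n) 0ℓ
AdjWithout G S u v = u ∉ S × v ∉ S × Adj G u v

-- Two vertices of G − S lie in different components.
VertexCut : ∀ {n} → Graph n → Subset n → Set
VertexCut G S =
  ∃₂ λ u v → u ∉ S × v ∉ S × ¬ Star (AdjWithout G S) u v

Complete : ∀ {n} → Graph n → Set
Complete G = ∀ {u v} → u ≢ v → Adj G u v

-- κ(G) ≡ k, as a functional relation, so that no search for a minimum is needed.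
HasConnectivity : ∀ {n} → Graph n → ℕ → Set
HasConnectivity {n} G k =
  (Complete G × k ≡ n ∸ 1)
  ⊎ (¬ Complete G
     × (∃ λ S → VertexCut G S × ∣ S ∣ ≡ k)
     × (∀ S → VertexCut G S → k ≤ ∣ S ∣))

Connected : ℕ → ∀ {n} → Graph n → Set
Connected k G = ∃ λ κ → HasConnectivity G κ × k ≤ κ

bound : ℕ → ℚᵘ
bound n with parity n
... | 1ℙ = (+ 3 / 2) * (+ n / 1) - (+ 3 / 2)
... | 0ℙ = (+ 3 / 2) * (+ n / 1) - (+ 2 / 1)

{-# OPTIONS --safe #-}
module Submission where

-- Lower bound.  Grow a connected vertex set from an edge, always adding k ∈ {1, 2} vertices
-- together with at least k + 1 edges; this keeps 2 · edges ≥ 3 · vertices − 4.  If neither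
-- kind of step is available, take u in the set H with a neighbour outside.  As G − u is
-- connected, some walk outside H leads from a neighbour of u to a neighbour of H − u.  A
-- shortest one has at least three vertices, and a shortest path through H closes it to an
-- induced cycle; its length is not 5 by parity, so it is at least 6: a contradiction.
--
-- Sharpness.  Gluing 4-cycles along one edge, starting from K₂,₂ or K₂,₃, adds two vertices and
-- three edges each time.  A cycle through the new vertices a, b uses a path x₀ a b y₀, and
-- x₀y₀ is a chord if the cycle has length at least 6.

open import Defs
open import Data.Bool as Bool using (Bool; true; false; not)
open import Data.Bool.Properties using (not-involutive; ¬-not)
open import Data.Empty using (⊥; ⊥-elim)
open import Data.Fin as Fin using (Fin; zero; suc; toℕ; fromℕ<)
import Data.Fin.Properties as Fin
open import Data.Fin.Subset using (Subset; Side; inside; outside; ∁; ∣_∣; ⁅_⁆)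
  renaming (_∈_ to _∈ₛ_; _∉_ to _∉ₛ_; ⊥ to ∅)
open import Data.Fin.Subset.Properties
  using (x∈⁅x⁆; x∈⁅y⁆⇒x≡y; ∣⁅x⁆∣≡1; ∣⊥∣≡0; ∉⊥; x∉p⇒x∈∁p; x∈∁p⇒x∉p; x∈p⇒∣p-x∣<∣p∣; x∈p∧x≢y⇒x∈p-y)
  renaming (_∈?_ to _∈ₛ?_)
open import Data.Integer as ℤ using (+_; -[1+_])
import Data.Integer.Properties as ℤ
import Data.Integer.Tactic.RingSolver as ℤ
open import Data.List using (List; []; _∷_; _++_; map; length; lookup; allFin; cartesianProduct)
open import Data.List.Properties using (length-map; length-++; length-tabulate)
open import Data.List.Membership.Propositional using (_∈_; _∉_)
open import Data.List.Membership.Propositional.Properties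
open import Data.List.Membership.DecPropositional using (_∈?_)
open import Data.List.Relation.Unary.Any using (here; there; index)
open import Data.List.Relation.Unary.Any.Properties using (lookup-index)
import Data.List.Relation.Unary.All as All
open import Data.List.Relation.Unary.All using ([]; _∷_)
open import Data.List.Relation.Unary.AllPairs using ([]; _∷_)
open import Data.List.Relation.Unary.Unique.Propositional using (Unique)
import Data.List.Relation.Unary.Unique.Propositional.Properties as Unique
open import Data.List.Relation.Binary.Subset.Propositional using (_⊆_)
open import Data.Nat using (ℕ; zero; suc; _+_; _*_; _≤_; _<_; z≤n; s≤s; _≤?_; parity)
open import Data.Nat.Properties
open import Data.Nat.Induction using (<-rec)
open import Data.Parity as ℙ using (Parity; 0ℙ; 1ℙ)
import Data.Parity.Properties as ℙ
open import Data.Product using (∃; _×_; _,_; proj₁; proj₂)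
open import Data.Product.Properties using (,-injective)
open import Data.Rational.Unnormalised using (_/_; _≃_; *≤*) renaming (_≤_ to _≤ℚ_)
import Data.Rational.Unnormalised.Properties as ℚ
open import Data.Sum using (_⊎_; inj₁; inj₂; swap)
open import Data.Unit using (⊤; tt)
open import Data.Vec as Vec using (here; there)
open import Data.Vec.Properties using (lookup∘tabulate; lookup⇒[]=; []=⇒lookup)
open import Function using (_∘_; id)
open import Function.Definitions using (Injective)
open import Level using (0ℓ)
open import Relation.Binary using (Rel; tri<; tri≈; tri>)
open import Relation.Binary.Construct.Closure.ReflexiveTransitive as Star
  using (Star; ε; _◅_; _◅◅_; reverse)
open import Relation.Binary.PropositionalEquality
  using (_≡_; _≢_; refl; trans; cong; cong₂; subst; subst₂; module ≡-Reasoning)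
  renaming (sym to ≡-sym)
open import Relation.Nullary using (Dec; ¬_; yes; no; contradiction)
open import Relation.Nullary.Decidable using (decidable-stable; ¬?)

private
  variable
    A : Set
    n : ℕ

-- Counting through duplicate-free lists.

lookup-injective : ∀ {xs : List A} → Unique xs → Injective _≡_ _≡_ (lookup xs)
lookup-injective (_ ∷ _) {zero} {zero} _ = refl
lookup-injective (x∉ ∷ _) {zero} {suc j} eq = contradiction eq (All.lookup x∉ (∈-lookup j))
lookup-injective (x∉ ∷ _) {suc i} {zero} eq = contradiction (≡-sym eq) (All.lookup x∉ (∈-lookup i))
lookup-injective (_ ∷ u) {suc i} {suc j} eq = cong suc (lookup-injective u eq)

unique-⊆⇒length≤ : ∀ {xs ys : List A} → Unique xs → xs ⊆ ys → length xs ≤ length ys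
unique-⊆⇒length≤ {xs = xs} {ys} u xs⊆ys = Fin.injective⇒≤ {f = f} inj
  where
  f : Fin (length xs) → Fin (length ys)
  f i = index (xs⊆ys (∈-lookup {xs = xs} i))
  inj : Injective _≡_ _≡_ f
  inj {i} {j} eq = lookup-injective u (begin
    lookup xs i      ≡⟨ lookup-index (xs⊆ys (∈-lookup {xs = xs} i)) ⟩
    lookup ys (f i)  ≡⟨ cong (lookup ys) eq ⟩
    lookup ys (f j)  ≡⟨ lookup-index (xs⊆ys (∈-lookup {xs = xs} j)) ⟨
    lookup xs j      ∎)
    where open ≡-Reasoning

edges-unique : (G : Graph n) → Unique (edges G)
edges-unique {n} G = Unique.filter⁺ _ (Unique.cartesianProduct⁺ (Unique.allFin⁺ n) (Unique.allFin⁺ n))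

∈-edges⁺ : (G : Graph n) → ∀ {u v} → u Fin.< v → Adj G u v → (u , v) ∈ edges G
∈-edges⁺ G u<v uv = ∈-filter⁺ _ (∈-cartesianProduct⁺ (∈-allFin _) (∈-allFin _)) (u<v , uv)

∈-edges⁻ : (G : Graph n) → ∀ {u v} → (u , v) ∈ edges G → u Fin.< v × Adj G u v
∈-edges⁻ {n} G uv∈ = proj₂ (∈-filter⁻ _ {xs = cartesianProduct (allFin n) (allFin n)} uv∈)

-- Shortest walks

-- The ends are predicates, so that a shortest walk is taken among all walks between two vertex
-- sets. Values `at i` with `i > m` are arbitrary.
record Walk (R : Rel A 0ℓ) (P Q : A → Set) (m : ℕ) : Set where
  field
    at    : ℕ → A
    start : P (at 0)
    end   : Q (at m)
    step  : ∀ {i} → i < m → R (at i) (at (suc i))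

open Walk

module _ {R : Rel A 0ℓ} {Q : A → Set} where

  single : ∀ {P x} → P x → Q x → Walk R P Q 0
  single {x = x} px qx = record { at = λ _ → x ; start = px ; end = qx ; step = λ () }

  cons : ∀ {P m} x → P x → Walk R (R x) Q m → Walk R P Q (suc m)
  cons x px w = record
    { at    = λ { zero → x ; (suc i) → at w i }
    ; start = px
    ; end   = end w
    ; step  = λ { {zero} _ → start w ; {suc i} (s≤s i<m) → step w i<m }
    }

  mapStart : ∀ {P P′ m} → (∀ {x} → P x → P′ x) → Walk R P Q m → Walk R P′ Q m
  mapStart f w = record { at = at w ; start = f (start w) ; end = end w ; step = step w }

  drop : ∀ {P P′ r} k (w : Walk R P Q (k + r)) → P′ (at w k) → Walk R P′ Q r
  drop {P′ = P′} k w p = record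
    { at    = λ i → at w (k + i)
    ; start = subst (P′ ∘ at w) (≡-sym (+-identityʳ k)) p
    ; end   = end w
    ; step  = λ {i} i<r → subst (R (at w (k + i)) ∘ at w) (≡-sym (+-suc k i))
                                (step w (+-monoʳ-< k i<r))
    }

  take : ∀ {P m i} (w : Walk R P Q m) → i ≤ m → Q (at w i) → Walk R P Q i
  take w i≤m q = record
    { at = at w ; start = start w ; end = q ; step = λ j<i → step w (<-≤-trans j<i i≤m) }

  shortcut : ∀ {P r} i d (w : Walk R P Q (suc (i + d) + r)) →
             R (at w i) (at w (suc (i + d))) → Walk R P Q (suc (i + r))
  shortcut zero    d w e = cons (at w 0) (start w) (drop (suc d) w e)
  shortcut (suc i) d w e =
    cons (at w 0) (start w) (shortcut i d (drop 1 w (step w (s≤s z≤n))) e)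

  star⇒walk : ∀ {x y} → Q y → Star R x y → ∃ (Walk R (_≡ x) Q)
  star⇒walk q ε = 0 , single refl q
  star⇒walk q (_◅_ {i = x} r s) with star⇒walk q s
  ... | m , w = suc m , cons x refl (mapStart (λ { refl → r }) w)

Minimal : ∀ {R : Rel A 0ℓ} {P Q m} → Walk R P Q m → Set
Minimal {R = R} {P} {Q} {m} _ = ∀ {m′} → m′ < m → ¬ Walk R P Q m′

-- A shortest walk exists only up to ¬ ¬, since neither R, P nor Q is decidable.
minimalWalk : ∀ {R : Rel A 0ℓ} {P Q} →
              (∀ {m} (w : Walk R P Q m) → Minimal w → ⊥) → ∀ {m} → ¬ Walk R P Q m
minimalWalk {R = R} {P} {Q} noMin {m} =
  <-rec (λ m → ¬ Walk R P Q m) (λ _ rec w → noMin w (λ lt → rec lt)) m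

module Shortest {R : Rel A 0ℓ} {P Q m} (w : Walk R P Q m) (minimal : Minimal w) where

  start-only : ∀ {i} → i ≤ m → P (at w i) → i ≡ 0
  start-only {zero}  _   _ = refl
  start-only {suc i} i≤m p with m≤n⇒∃[o]m+o≡n i≤m
  ... | r , refl = ⊥-elim (minimal (s≤s (m≤n+m r i)) (drop (suc i) w p))

  end-only : ∀ {i} → i ≤ m → Q (at w i) → i ≡ m
  end-only i≤m q with m≤n⇒m<n∨m≡n i≤m
  ... | inj₁ i<m = ⊥-elim (minimal i<m (take w i≤m q))
  ... | inj₂ i≡m = i≡m

  induced : ∀ {i j} → i < j → j ≤ m → R (at w i) (at w j) → j ≡ suc i
  induced {i} i<j j≤m e with m≤n⇒∃[o]m+o≡n i<j
  ... | zero  , refl = cong suc (+-identityʳ i)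
  ... | suc d , refl with m≤n⇒∃[o]m+o≡n j≤m
  ...   | r , refl = ⊥-elim (minimal shorter (shortcut i (suc d) w e))
    where
    shorter : suc (i + r) < suc (i + suc d) + r
    shorter = s≤s (+-monoˡ-< r (m<m+n i (s≤s z≤n)))

  -- A repetition lets `at w i` take over the outgoing edge of `at w j`, against `induced`; for
  -- `j ≡ m`, the vertex `at w i` already satisfies `Q`, against `end-only`.
  distinct : ∀ {i j} → i < j → j ≤ m → at w i ≢ at w j
  distinct {i} {j} i<j j≤m eq with m≤n⇒m<n∨m≡n j≤m
  ... | inj₁ j<m = <-irrefl (≡-sym (suc-injective
          (induced (m<n⇒m<1+n i<j) j<m (subst (λ x → R x (at w (suc j))) (≡-sym eq) (step w j<m))))) i<j
  ... | inj₂ refl = <-irrefl (end-only (<⇒≤ i<j) (subst Q (≡-sym eq) (end w))) i<j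

  injective-at : ∀ {i j} → i ≤ m → j ≤ m → at w i ≡ at w j → i ≡ j
  injective-at {i} {j} i≤m j≤m eq with <-cmp i j
  ... | tri< i<j _ _ = contradiction eq (distinct i<j j≤m)
  ... | tri≈ _ i≡j _ = i≡j
  ... | tri> _ _ j<i = contradiction (≡-sym eq) (distinct j<i i≤m)

join : ℕ → (ℕ → A) → (ℕ → A) → ℕ → A
join _       p q zero    = p 0
join zero    p q (suc t) = q t
join (suc m) p q (suc t) = join m (p ∘ suc) q t

join-left : ∀ {m t} {p q : ℕ → A} → t ≤ m → join m p q t ≡ p t
join-left {t = zero}          _       = refl
join-left {m = suc m} {suc t} (s≤s h) = join-left h

join-right : ∀ m s {p q : ℕ → A} → join m p q (suc (m + s)) ≡ q s
join-right zero    s = refl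
join-right (suc m) s = join-right m s

-- Indices beyond `m` are written `suc (m + s)`, the form that `join-right` evaluates.
data Split (m l : ℕ) : ℕ → Set where
  left  : ∀ {t} → t ≤ m → Split m l t
  right : ∀ {s} → s ≤ l → Split m l (suc (m + s))

split : ∀ {m l t} → t < suc m + suc l → Split m l t
split {m} {l} {t} t<L with t ≤? m
... | yes t≤m = left t≤m
... | no  t≰m with m≤n⇒∃[o]m+o≡n (≰⇒> t≰m)
...   | s , refl = right (≤-pred (+-cancelˡ-≤ (suc m) (suc s) (suc l)
                     (subst (_≤ suc m + suc l) (≡-sym (+-suc (suc m) s)) t<L)))

-- Induced cycles

module ChordalBipartiteGraph (G : Graph n) (cb : ChordalBipartite G) where

  private
    X = proj₁ (proj₁ cb)

  side : Fin n → Side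
  side = Vec.lookup X

  adjacent⇒side≢ : ∀ {u v} → Adj G u v → side u ≢ side v
  adjacent⇒side≢ {u} {v} uv eq with side u in equ | side v in eqv
  ... | true  | true  = proj₁ (proj₂ (proj₁ cb)) (lookup⇒[]= u X equ) (lookup⇒[]= v X eqv) uv
  ... | false | false = proj₂ (proj₂ (proj₁ cb)) (out equ) (out eqv) uv
    where
    out : ∀ {x} → side x ≡ outside → x ∈ₛ ∁ X
    out {x} eqx = x∉p⇒x∈∁p (λ x∈ → contradiction (trans (≡-sym eqx) ([]=⇒lookup x∈)) λ ())

  side-two-steps : ∀ {u v w} → Adj G u v → Adj G v w → side u ≡ side w
  side-two-steps uv vw =
    trans (trans (¬-not (adjacent⇒side≢ uv)) (cong not (¬-not (adjacent⇒side≢ vw)))) (not-involutive _)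

  no-5-cycle : ∀ {a b c d e} →
               Adj G a b → Adj G b c → Adj G c d → Adj G d e → ¬ Adj G e a
  no-5-cycle ab bc cd de ea =
    adjacent⇒side≢ ea (≡-sym (trans (side-two-steps ab bc) (side-two-steps cd de)))

  -- A chord granted by chordal bipartiteness would join two positions that are cyclically
  -- consecutive by `chordless`. The order `i < j` is fixed in the hypotheses; symmetry covers the
  -- other one.
  no-long-induced-cycle : (c : ℕ → Fin n) (L : ℕ) → 6 ≤ L →
    (∀ {i j} → i < j → j < L → c i ≢ c j) →
    (∀ {i} → suc i < L → Adj G (c i) (c (suc i))) →
    (∀ {i} → suc i ≡ L → Adj G (c i) (c 0)) →
    (∀ {i j} → i < j → j < L → Adj G (c i) (c j) → (j ≡ suc i) ⊎ (i ≡ 0 × suc j ≡ L)) → ⊥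
  no-long-induced-cycle c L 6≤L distinct forward closing chordless =
    noChord (proj₂ cb C 6≤L)
    where
    f : Fin L → Fin n
    f = c ∘ toℕ

    f-injective : Injective _≡_ _≡_ f
    f-injective {i} {j} eq with <-cmp (toℕ i) (toℕ j)
    ... | tri< i<j _ _ = contradiction eq (distinct i<j (Fin.toℕ<n j))
    ... | tri≈ _ i≡j _ = Fin.toℕ-injective i≡j
    ... | tri> _ _ j<i = contradiction (≡-sym eq) (distinct j<i (Fin.toℕ<n i))

    f-adjacent : ∀ {i j} → Next i j → Adj G (f i) (f j)
    f-adjacent {i} {j} (inj₁ j≡1+i) =
      subst (Adj G (f i) ∘ c) (≡-sym j≡1+i) (forward (subst (_< L) j≡1+i (Fin.toℕ<n j)))
    f-adjacent {i} (inj₂ (last , j≡0)) = subst (Adj G (f i) ∘ c) (≡-sym j≡0) (closing last)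

    C : Cycle G
    C = record { len = L ; 3≤len = ≤-trans (s≤s (s≤s (s≤s z≤n))) 6≤L ; vertex = f
               ; injective = f-injective ; adjacent = f-adjacent }

    next : ∀ {i j} → toℕ i < toℕ j → Adj G (f i) (f j) → Next i j ⊎ Next j i
    next {j = j} i<j e with chordless i<j (Fin.toℕ<n j) e
    ... | inj₁ j≡1+i         = inj₁ (inj₁ j≡1+i)
    ... | inj₂ (i≡0 , last) = inj₂ (inj₂ (last , i≡0))

    noChord : ¬ (∃ λ u → ∃ λ v → Chord C u v)
    noChord (_ , _ , e , ¬ce , (i , refl) , (j , refl)) with <-cmp (toℕ i) (toℕ j)
    ... | tri< i<j _ _ = ¬ce (i , j , next i<j e , refl , refl)
    ... | tri≈ _ i≡j _ = irrefl G (cong c i≡j) e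
    ... | tri> _ _ j<i = ¬ce (i , j , swap (next j<i (sym G e)) , refl , refl)

-- The ear argument

-- No growth step is available: `one-neighbour` excludes adding one vertex with two edges,
-- `independent` excludes adding two adjacent vertices with three.
module Ear (G : Graph n) (cb : ChordalBipartite G)
  (vs : List (Fin n))
  (connected : ∀ {x y} → x ∈ vs → y ∈ vs → Star (λ a b → a ∈ vs × b ∈ vs × Adj G a b) x y)
  (one-neighbour : ∀ {v a b} → v ∉ vs → a ∈ vs → b ∈ vs → a ≢ b → Adj G v a → ¬ Adj G v b)
  (independent : ∀ {p q a b} → p ∉ vs → q ∉ vs → a ∈ vs → b ∈ vs →
                 Adj G p q → Adj G p a → ¬ Adj G q b)
  where

  open ChordalBipartiteGraph G cb

  Inner Outer : Rel (Fin n) 0ℓ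
  Inner x y = x ∈ vs × y ∈ vs × Adj G x y
  Outer x y = x ∉ vs × y ∉ vs × Adj G x y

  -- An `Outer` walk from `Attached u` to `Elsewhere u` is the interior of an ear of `vs` from `u`
  -- to another vertex.
  Attached Elsewhere : Fin n → Fin n → Set
  Attached  u x = x ∉ vs × Adj G u x
  Elsewhere u x = x ∉ vs × ∃ λ z → z ∈ vs × z ≢ u × Adj G x z

  -- The cycle `c` follows `w` outside `vs`, enters at `z`, follows `v` inside to `u`, and closes
  -- with the edge from `u` to `p 0`.
  module Closed {u z m l} (u∈ : u ∈ vs) (z∈ : z ∈ vs)
    (w : Walk Outer (Attached u) (Elsewhere u) m) (w-min : Minimal w)
    (mz : Adj G (at w m) z) (z≢u : z ≢ u)
    (v : Walk Inner (_≡ z) (_≡ u) l) (v-min : Minimal v) where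

    module W = Shortest w w-min
    module V = Shortest v v-min

    p q : ℕ → Fin n
    p = at w
    q = at v

    p∉ : ∀ {i} → i ≤ m → p i ∉ vs
    p∉ i≤m with m≤n⇒m<n∨m≡n i≤m
    ... | inj₁ i<m  = proj₁ (step w i<m)
    ... | inj₂ refl = proj₁ (end w)

    q∈ : ∀ {s} → s ≤ l → q s ∈ vs
    q∈ {zero}  _   = subst (_∈ vs) (≡-sym (start v)) z∈
    q∈ {suc s} s<l = proj₁ (proj₂ (step v s<l))

    p-step : ∀ {i} → i < m → Adj G (p i) (p (suc i))
    p-step i<m = proj₂ (proj₂ (step w i<m))

    q-step : ∀ {s} → s < l → Adj G (q s) (q (suc s))
    q-step s<l = proj₂ (proj₂ (step v s<l))

    pm-q0 : Adj G (p m) (q 0)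
    pm-q0 = subst (Adj G (p m)) (≡-sym (start v)) mz

    ql-p0 : Adj G (q l) (p 0)
    ql-p0 = subst (λ x → Adj G x (p 0)) (≡-sym (end v)) (proj₂ (start w))

    -- If `q s ≡ u`, then `p i` could start the outer walk, so `i ≡ 0`. Otherwise `p i` could end
    -- it, so `i ≡ m`, and `one-neighbour` leaves only `z`.
    cross : ∀ {i s} → i ≤ m → s ≤ l → Adj G (p i) (q s) → (i ≡ m × s ≡ 0) ⊎ (i ≡ 0 × s ≡ l)
    cross {i} {s} i≤m s≤l e with q s Fin.≟ u
    ... | yes qs≡u = inj₂
      ( W.start-only i≤m (p∉ i≤m , sym G (subst (Adj G (p i)) qs≡u e))
      , V.injective-at s≤l ≤-refl (trans qs≡u (≡-sym (end v))) )
    ... | no qs≢u with W.end-only i≤m (p∉ i≤m , q s , q∈ s≤l , qs≢u , e)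
    ...   | refl with q s Fin.≟ z
    ...     | yes qs≡z = inj₁ (refl , V.injective-at s≤l z≤n (trans qs≡z (≡-sym (start v))))
    ...     | no qs≢z = ⊥-elim (one-neighbour (p∉ ≤-refl) (q∈ s≤l) z∈ qs≢z e mz)

    c : ℕ → Fin n
    c = join m p q

    L : ℕ
    L = suc m + suc l

    cˡ : ∀ {t} → t ≤ m → c t ≡ p t
    cˡ = join-left

    cʳ : ∀ s → c (suc (m + s)) ≡ q s
    cʳ s = join-right m s

    c-distinct : ∀ {i j} → i < j → j < L → c i ≢ c j
    c-distinct i<j j<L eq with split {m} {l} (<-trans i<j j<L) | split {m} {l} j<L
    ... | left i≤m | left j≤m = W.distinct i<j j≤m (trans (≡-sym (cˡ i≤m)) (trans eq (cˡ j≤m)))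
    ... | left i≤m | right {s} s≤l =
      p∉ i≤m (subst (_∈ vs) (trans (≡-sym (cʳ s)) (trans (≡-sym eq) (cˡ i≤m))) (q∈ s≤l))
    ... | right {s} _ | left j≤m = <-irrefl refl (<-trans i<j (s≤s (≤-trans j≤m (m≤m+n m s))))
    ... | right {s} _ | right {t} t≤l =
      V.distinct (+-cancelˡ-< (suc m) s t i<j) t≤l (trans (≡-sym (cʳ s)) (trans eq (cʳ t)))

    c-forward : ∀ {i} → suc i < L → Adj G (c i) (c (suc i))
    c-forward {i} 1+i<L with split {m} {l} (<-trans (n<1+n i) 1+i<L)
    ... | left i≤m with m≤n⇒m<n∨m≡n i≤m
    ...   | inj₁ i<m rewrite cˡ i≤m | cˡ i<m = p-step i<m
    ...   | inj₂ refl = subst (λ k → Adj G (c m) (c (suc k))) (+-identityʳ m) joint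
      where
      joint : Adj G (c m) (c (suc (m + 0)))
      joint rewrite cˡ i≤m | cʳ 0 = pm-q0
    c-forward 1+i<L | right {s} _ =
      subst (λ k → Adj G (c (suc (m + s))) (c (suc k))) (+-suc m s) inner
      where
      s<l : s < l
      s<l = ≤-pred (+-cancelˡ-< (suc m) (suc s) (suc l)
              (subst (_< L) (≡-sym (+-suc (suc m) s)) 1+i<L))
      inner : Adj G (c (suc (m + s))) (c (suc (m + suc s)))
      inner rewrite cʳ s | cʳ (suc s) = q-step s<l

    c-closing : ∀ {i} → suc i ≡ L → Adj G (c i) (c 0)
    c-closing eq with suc-injective (trans eq (+-suc (suc m) l))
    ... | refl rewrite cʳ l = ql-p0

    c-chordless : ∀ {i j} → i < j → j < L → Adj G (c i) (c j) →
                  (j ≡ suc i) ⊎ (i ≡ 0 × suc j ≡ L)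
    c-chordless i<j j<L e with split {m} {l} (<-trans i<j j<L) | split {m} {l} j<L
    ... | left i≤m | left j≤m rewrite cˡ i≤m | cˡ j≤m =
      inj₁ (W.induced i<j j≤m (p∉ i≤m , p∉ j≤m , e))
    ... | right {s} _ | left j≤m =
      ⊥-elim (<-irrefl refl (<-trans i<j (s≤s (≤-trans j≤m (m≤m+n m s)))))
    ... | right {s} s≤l | right {t} t≤l rewrite cʳ s | cʳ t =
      inj₁ (trans (cong (λ k → suc (m + k))
                    (V.induced (+-cancelˡ-< (suc m) s t i<j) t≤l (q∈ s≤l , q∈ t≤l , e)))
                  (+-suc (suc m) s))
    ... | left i≤m | right {s} s≤l rewrite cˡ i≤m | cʳ s with cross i≤m s≤l e
    ...   | inj₁ (refl , refl) = inj₁ (cong suc (+-identityʳ m))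
    ...   | inj₂ (refl , refl) = inj₂ (refl , ≡-sym (+-suc (suc m) l))

    absurd-long : 6 ≤ L → ⊥
    absurd-long 6≤L =
      no-long-induced-cycle c L 6≤L c-distinct c-forward c-closing c-chordless

  -- For `l = 0` the ends coincide. Then `m = 0` contradicts `one-neighbour`, `m = 1` contradicts
  -- `independent`, and `m = 2`, `l = 1` gives an odd closed walk. In all other cases the length
  -- `m + l + 2` is at least 6.
  no-closed-ear : ∀ {u z} m l → u ∈ vs → z ∈ vs →
    (w : Walk Outer (Attached u) (Elsewhere u) m) → Minimal w →
    Adj G (at w m) z → z ≢ u →
    (v : Walk Inner (_≡ z) (_≡ u) l) → Minimal v → ⊥
  no-closed-ear _ zero _ _ _ _ _ z≢u v _ = z≢u (trans (≡-sym (start v)) (end v))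
  no-closed-ear zero (suc l) u∈ z∈ w _ mz z≢u _ _ =
    one-neighbour (proj₁ (start w)) z∈ u∈ z≢u mz (sym G (proj₂ (start w)))
  no-closed-ear 1 (suc l) u∈ z∈ w _ mz _ _ _ with step w {0} (s≤s z≤n)
  ... | p∉ , q∉ , pq = independent p∉ q∉ u∈ z∈ pq (sym G (proj₂ (start w))) mz
  no-closed-ear 2 1 u∈ z∈ w w-min mz z≢u v v-min =
    no-5-cycle (p-step {0} (s≤s z≤n)) (p-step {1} (s≤s (s≤s z≤n))) pm-q0 (q-step (s≤s z≤n)) ql-p0
    where open Closed u∈ z∈ w w-min mz z≢u v v-min
  no-closed-ear 2 (suc (suc l)) u∈ z∈ w w-min mz z≢u v v-min =
    Closed.absurd-long u∈ z∈ w w-min mz z≢u v v-min (+-monoʳ-≤ 3 (s≤s (s≤s (s≤s z≤n))))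
  no-closed-ear (suc (suc (suc m))) (suc l) u∈ z∈ w w-min mz z≢u v v-min =
    Closed.absurd-long u∈ z∈ w w-min mz z≢u v v-min
      (+-mono-≤ (s≤s (s≤s (s≤s (s≤s (z≤n {m}))))) (s≤s (s≤s (z≤n {l}))))

  -- The outer walk is minimised first: its end fixes `z`, and only then is a shortest inner walk
  -- from `z` to `u` chosen.
  no-ear : ∀ {u m} → u ∈ vs → ¬ Walk Outer (Attached u) (Elsewhere u) m
  no-ear u∈ = minimalWalk λ w w-min → let (_ , z , z∈ , z≢u , mz) = end w in
    minimalWalk (λ v v-min → no-closed-ear _ _ u∈ z∈ w w-min mz z≢u v v-min)
                (proj₂ (star⇒walk refl (connected z∈ u∈)))

  -- Follow the walk up to its first vertex in `vs`, which differs from `u` because `u` has been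
  -- deleted.
  first-return : ∀ {u x y} → u ∈ vs → x ∉ vs → y ∈ vs →
                 Star (AdjWithout G ⁅ u ⁆) x y → ∃ (Walk Outer (_≡ x) (Elsewhere u))
  first-return u∈ x∉ y∈ ε = contradiction y∈ x∉
  first-return {u} {x} u∈ x∉ y∈ (_◅_ {j = y} (_ , y∉u , xy) s) with _∈?_ Fin._≟_ y vs
  ... | yes y∈vs =
    0 , single refl (x∉ , y , y∈vs , (λ { refl → y∉u (x∈⁅x⁆ u) }) , xy)
  ... | no y∉ with first-return u∈ y∉ y∈ s
  ...   | m , w = suc m , cons x refl (mapStart (λ { refl → x∉ , y∉ , xy }) w)

-- The lower bound

noSmallCut : {G : Graph n} → Connected 2 G → ∀ S → ∣ S ∣ < 2 → ¬ VertexCut G S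
noSmallCut (_ , inj₁ (complete , _) , _) S _ (u , v , u∉S , v∉S , ¬uv) with u Fin.≟ v
... | yes refl = ¬uv ε
... | no u≢v   = ¬uv ((u∉S , v∉S , complete u≢v) ◅ ε)
noSmallCut (_ , inj₂ (_ , _ , minimum) , 2≤κ) S small cut =
  <⇒≱ small (≤-trans 2≤κ (minimum S cut))

-- Orients a pair as `edges` lists it, so that an edge gives the same entry from either end.
edge : Fin n → Fin n → Fin n × Fin n
edge u v with u Fin.<? v
... | yes _ = u , v
... | no _  = v , u

edge-cases : (u v : Fin n) → (edge u v ≡ (u , v)) ⊎ (edge u v ≡ (v , u))
edge-cases u v with u Fin.<? v
... | yes _ = inj₁ refl
... | no _  = inj₂ refl

edge∈ : (G : Graph n) → ∀ {u v} → Adj G u v → edge u v ∈ edges G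
edge∈ G {u} {v} uv with u Fin.<? v
... | yes u<v = ∈-edges⁺ G u<v uv
... | no u≮v  = ∈-edges⁺ G (≤∧≢⇒< (≮⇒≥ u≮v) v≢u) (sym G uv)
  where
  v≢u : toℕ v ≢ toℕ u
  v≢u eq = irrefl G (Fin.toℕ-injective (≡-sym eq)) uv

edge-injectiveʳ : (u : Fin n) → Injective _≡_ _≡_ (edge u)
edge-injectiveʳ u {v} {w} eq with edge-cases u v | edge-cases u w
... | inj₁ p | inj₁ q = proj₂ (,-injective (trans (≡-sym p) (trans eq q)))
... | inj₂ p | inj₂ q = proj₁ (,-injective (trans (≡-sym p) (trans eq q)))
... | inj₁ p | inj₂ q with ,-injective (trans (≡-sym p) (trans eq q))
...   | refl , refl = refl
edge-injectiveʳ u {v} {w} eq | inj₂ p | inj₁ q with ,-injective (trans (≡-sym p) (trans eq q))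
...   | refl , refl = refl

-- `es` may omit edges inside `vs`, and `connected` may use any edge of `G` inside `vs`.
record Partial (G : Graph n) (a b : ℕ) : Set where
  field
    vs        : List (Fin n)
    vs-unique : Unique vs
    vs-length : length vs ≡ a
    es        : List (Fin n × Fin n)
    es-unique : Unique es
    es-length : length es ≡ b
    es⊆edges  : es ⊆ edges G
    es-ends   : ∀ {x y} → (x , y) ∈ es → x ∈ vs × y ∈ vs
    connected : ∀ {x y} → x ∈ vs → y ∈ vs → Star (λ a b → a ∈ vs × b ∈ vs × Adj G a b) x y

module _ {G : Graph n} where

  point : Fin n → Partial G 1 0
  point x = record
    { vs = x ∷ [] ; vs-unique = [] ∷ [] ; vs-length = refl
    ; es = [] ; es-unique = [] ; es-length = refl
    ; es⊆edges = λ () ; es-ends = λ ()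
    ; connected = λ { (here refl) (here refl) → ε }
    }

  module _ {a b} (H : Partial G a b) where

    open Partial H

    -- Old edges have both ends in `vs`, so the edges at `v` are new. The neighbour list is nonempty
    -- and its head `w` is a hub that every vertex reaches.
    extend : ∀ {v w} ns → v ∉ vs → Unique (w ∷ ns) →
             (∀ {x} → x ∈ w ∷ ns → x ∈ vs × Adj G v x) →
             Partial G (suc a) (length (w ∷ ns) + b)
    extend {v} {w} ns v∉ ns-unique attached = record
      { vs        = vs′
      ; vs-unique = All.tabulate (λ x∈ v≡x → v∉ (subst (_∈ vs) (≡-sym v≡x) x∈)) ∷ vs-unique
      ; vs-length = cong suc vs-length
      ; es        = map (edge v) (w ∷ ns) ++ es
      ; es-unique = Unique.++⁺ (Unique.map⁺ (edge-injectiveʳ v) ns-unique) es-unique disjoint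
      ; es-length = trans (length-++ (map (edge v) (w ∷ ns)))
                          (cong₂ _+_ (length-map (edge v) (w ∷ ns)) es-length)
      ; es⊆edges  = λ e∈ → ⊆edges (∈-++⁻ (map (edge v) (w ∷ ns)) e∈)
      ; es-ends   = λ e∈ → ends (∈-++⁻ (map (edge v) (w ∷ ns)) e∈)
      ; connected = λ x∈ y∈ → to-w x∈ ◅◅ reverse symmetric (to-w y∈)
      }
      where
      vs′ = v ∷ vs

      Within : Rel (Fin n) 0ℓ
      Within x y = x ∈ vs′ × y ∈ vs′ × Adj G x y

      symmetric : ∀ {x y} → Within x y → Within y x
      symmetric (x∈ , y∈ , xy) = y∈ , x∈ , sym G xy

      to-w : ∀ {x} → x ∈ vs′ → Star Within x w
      to-w (here refl) with attached (here refl)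
      ... | w∈ , vw = (here refl , there w∈ , vw) ◅ ε
      to-w (there x∈) = Star.map (λ { (a∈ , b∈ , ab) → there a∈ , there b∈ , ab })
                                 (connected x∈ (proj₁ (attached (here refl))))

      disjoint : ∀ {e} → ¬ (e ∈ map (edge v) (w ∷ ns) × e ∈ es)
      disjoint (e∈new , e∈old) with ∈-map⁻ (edge v) e∈new
      ... | x , _ , refl with edge-cases v x
      ...   | inj₁ eq = v∉ (proj₁ (es-ends (subst (_∈ es) eq e∈old)))
      ...   | inj₂ eq = v∉ (proj₂ (es-ends (subst (_∈ es) eq e∈old)))

      ⊆edges : ∀ {e} → (e ∈ map (edge v) (w ∷ ns)) ⊎ (e ∈ es) → e ∈ edges G
      ⊆edges (inj₂ e∈) = es⊆edges e∈
      ⊆edges (inj₁ e∈) with ∈-map⁻ (edge v) e∈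
      ... | x , x∈ , refl = edge∈ G (proj₂ (attached x∈))

      ends : ∀ {x y} → ((x , y) ∈ map (edge v) (w ∷ ns)) ⊎ ((x , y) ∈ es) → x ∈ vs′ × y ∈ vs′
      ends (inj₂ e∈) with es-ends e∈
      ... | x∈ , y∈ = there x∈ , there y∈
      ends (inj₁ e∈) with ∈-map⁻ (edge v) e∈
      ... | z , z∈ , eq with edge-cases v z
      ...   | inj₁ eq′ with ,-injective (trans eq eq′)
      ...     | refl , refl = here refl , there (proj₁ (attached z∈))
      ends (inj₁ e∈) | z , z∈ , eq | inj₂ eq′ with ,-injective (trans eq eq′)
      ...     | refl , refl = there (proj₁ (attached z∈)) , here refl

    some-other : 2 ≤ a → ∀ u → ∃ λ z → z ∈ vs × z ≢ u
    some-other 2≤a u with vs | vs-unique | vs-length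
    ... | []        | _            | refl = contradiction 2≤a λ ()
    ... | _ ∷ []    | _            | refl = contradiction 2≤a λ { (s≤s ()) }
    ... | x ∷ y ∷ _ | (x≢y ∷ _) ∷ _ | _ with x Fin.≟ u
    ...   | yes refl = y , there (here refl) , x≢y ∘ ≡-sym
    ...   | no x≢u   = x , here refl , x≢u

    covered⇒n≤ : (∀ x → x ∈ vs) → n ≤ a
    covered⇒n≤ all∈ = subst (_≤ a) (length-tabulate {n = n} id)
      (subst (length (allFin n) ≤_) vs-length
        (unique-⊆⇒length≤ (Unique.allFin⁺ n) (λ {x} _ → all∈ x)))

    b≤size : b ≤ size G
    b≤size = subst (_≤ size G) es-length (unique-⊆⇒length≤ es-unique es⊆edges)

crossing : ∀ {R : Rel (Fin n) 0ℓ} {vs x y} → x ∈ vs → y ∉ vs → Star R x y →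
           ∃ λ u → ∃ λ v → u ∈ vs × v ∉ vs × R u v
crossing x∈ y∉ ε = contradiction x∈ y∉
crossing {vs = vs} {x} x∈ y∉ (_◅_ {j = z} xz s) with _∈?_ Fin._≟_ z vs
... | yes z∈ = crossing z∈ y∉ s
... | no z∉  = x , z , x∈ , z∉ , xz

module LowerBound (G : Graph n) (conn : Connected 2 G) (cb : ChordalBipartite G) where

  -- Non-reachability would make `S` a small vertex cut. The double negation is harmless, since the
  -- final inequality is decidable.
  reachable : ∀ S → ∣ S ∣ < 2 → ∀ {u v} → u ∉ₛ S → v ∉ₛ S → ¬ ¬ Star (AdjWithout G S) u v
  reachable S small u∉S v∉S ¬uv = noSmallCut {G = G} conn S small (_ , _ , u∉S , v∉S , ¬uv)

  reachable-∅ : ∀ u v → ¬ ¬ Star (AdjWithout G ∅) u v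
  reachable-∅ u v = reachable ∅ (subst (_< 2) (≡-sym (∣⊥∣≡0 n)) (s≤s z≤n)) ∉⊥ ∉⊥

  reachable-⁅_⁆ : ∀ u {v w} → v ≢ u → w ≢ u → ¬ ¬ Star (AdjWithout G ⁅ u ⁆) v w
  reachable-⁅ u ⁆ v≢u w≢u =
    reachable ⁅ u ⁆ (subst (_< 2) (≡-sym (∣⁅x⁆∣≡1 u)) (s≤s (s≤s z≤n)))
              (v≢u ∘ x∈⁅y⁆⇒x≡y u) (w≢u ∘ x∈⁅y⁆⇒x≡y u)

  -- The constant 4 makes a single edge, `a = 2` and `b = 1`, an equality. Two vertices with three
  -- edges raise both sides by 6; one vertex with two edges raises them by 3 and 4.
  Sparse : ℕ → ℕ → Set
  Sparse a b = 3 * a ≤ 2 * b + 4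

  sparse₁ : ∀ {a b} → Sparse a b → Sparse (1 + a) (2 + b)
  sparse₁ {a} {b} h = begin
    3 * (1 + a)      ≡⟨ *-distribˡ-+ 3 1 a ⟩
    3 + 3 * a        ≤⟨ +-mono-≤ (n≤1+n 3) h ⟩
    4 + (2 * b + 4)  ≡⟨ cong (_+ 4) (*-distribˡ-+ 2 2 b) ⟨
    2 * (2 + b) + 4  ∎
    where open ≤-Reasoning

  sparse₂ : ∀ {a b} → Sparse a b → Sparse (2 + a) (3 + b)
  sparse₂ {a} {b} h = begin
    3 * (2 + a)      ≡⟨ *-distribˡ-+ 3 2 a ⟩
    6 + 3 * a        ≤⟨ +-monoʳ-≤ 6 h ⟩
    6 + (2 * b + 4)  ≡⟨ cong (_+ 4) (*-distribˡ-+ 2 3 b) ⟨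
    2 * (3 + b) + 4  ∎
    where open ≤-Reasoning

  finish : ∀ {a b} → Partial G a b → Sparse a b → n ≤ a → Sparse n (size G)
  finish H sparse n≤a = ≤-trans (*-monoʳ-≤ 3 n≤a)
    (≤-trans sparse (+-monoˡ-≤ 4 (*-monoʳ-≤ 2 (b≤size H))))

  -- `fuel` bounds the number of missing vertices. Given `¬goal`, the recursive call refutes every
  -- growth step, which supplies the hypotheses of `Ear`; hence nothing lies outside `vs`.
  grow : ∀ fuel {a b} → n ≤ fuel + a → 2 ≤ a → Partial G a b → Sparse a b →
         ¬ ¬ Sparse n (size G)
  grow zero n≤a _ H sparse ¬goal = ¬goal (finish H sparse n≤a)
  grow (suc fuel) {a} {b} n≤ 2≤a H sparse ¬goal =
    ¬goal (finish H sparse (covered⇒n≤ H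
      (λ x → decidable-stable (_∈?_ Fin._≟_ x vs) no-outsider)))
    where
    open Partial H

    n≤′ : n ≤ fuel + suc a
    n≤′ = subst (n ≤_) (≡-sym (+-suc fuel a)) n≤

    one-neighbour : ∀ {v x y} → v ∉ vs → x ∈ vs → y ∈ vs → x ≢ y → Adj G v x → ¬ Adj G v y
    one-neighbour {v} {x} {y} v∉ x∈ y∈ x≢y vx vy =
      grow fuel n≤′ (m≤n⇒m≤1+n 2≤a)
        (extend H (y ∷ []) v∉ ((x≢y ∷ []) ∷ [] ∷ [])
          λ { (here refl) → x∈ , vx ; (there (here refl)) → y∈ , vy })
        (sparse₁ {a} {b} sparse) ¬goal

    independent : ∀ {p q x y} → p ∉ vs → q ∉ vs → x ∈ vs → y ∈ vs →
                  Adj G p q → Adj G p x → ¬ Adj G q y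
    independent {p} {q} {x} {y} p∉ q∉ x∈ y∈ pq px qy =
      -- `p` brings its edge to `x`, then `q` brings edges to `p` and `y`. Two vertices cost one
      -- unit of fuel, so the bound on `n` is only weakened.
      grow fuel (≤-trans n≤′ (+-monoʳ-≤ fuel (n≤1+n (suc a)))) (m≤n⇒m≤o+n 2 2≤a)
        (extend (extend H [] p∉ ([] ∷ []) λ { (here refl) → x∈ , px }) (y ∷ []) q∉′
          (((λ { refl → p∉ y∈ }) ∷ []) ∷ [] ∷ [])
          λ { (here refl) → here refl , sym G pq ; (there (here refl)) → there y∈ , qy })
        (sparse₂ {a} {b} sparse) ¬goal
      where
      q∉′ : q ∉ p ∷ vs
      q∉′ (here refl) = irrefl G refl pq
      q∉′ (there q∈)  = q∉ q∈

    open Ear G cb vs connected one-neighbour independent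

    -- A walk from `vs` to `x` leaves `vs` along an edge from some `u` to some `v`; in `G − u`, a
    -- walk from `v` to another vertex `z` of `vs` then yields an ear at `u`.
    no-outsider : ∀ {x} → ¬ (x ∉ vs)
    no-outsider {x} x∉ with some-other H 2≤a x
    ... | y , y∈ , _ = reachable-∅ y x λ yx →
      let (u , v , u∈ , v∉ , _ , _ , uv) = crossing y∈ x∉ yx
          (z , z∈ , z≢u) = some-other H 2≤a u
      in reachable-⁅ u ⁆ (λ v≡u → v∉ (subst (_∈ vs) (≡-sym v≡u) u∈)) z≢u λ vz →
         no-ear u∈ (mapStart (λ { refl → v∉ , uv }) (proj₂ (first-return u∈ v∉ z∈ vz)))

  -- The walk from 0 to 1 is nonempty, so its first step is an edge at 0. This starts `grow` with
  -- two vertices and one edge, where `Sparse` reads `6 ≤ 6`.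
  size-bound : 4 ≤ n → 3 * n ≤ 2 * size G + 4
  size-bound (s≤s (s≤s _)) = decidable-stable (_ ≤? _) λ ¬goal →
    reachable-∅ zero (suc zero) λ { (_◅_ {j = y} (_ , _ , 0y) _) →
      grow n (m≤m+n n 2) ≤-refl
        (extend (point zero) [] (λ { (here refl) → irrefl G refl 0y }) ([] ∷ [])
          λ { (here refl) → here refl , sym G 0y })
        ≤-refl ¬goal }

-- Rational arithmetic

-- bound n = (3 n − slack (parity n)) / 2
slack : Parity → ℕ
slack 0ℙ = 4
slack 1ℙ = 3

private
  -- The rational order compares cross-products of unreduced fractions. These are the sides of the
  -- inequality over ℕ minus 4 for even `n`, and twice these sides minus 6 for odd `n`.
  shift : ∀ k {i j i′ j′} → (+ i) ℤ.- k ≡ i′ → (+ j) ℤ.- k ≡ j′ → i ≤ j → i′ ℤ.≤ j′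
  shift k refl refl i≤j = ℤ.+-monoˡ-≤ (ℤ.- k) (ℤ.+≤+ i≤j)

  even-num : ∀ a → a ℤ.- + 4 ≡ (a ℤ.* + 1 ℤ.+ -[1+ 1 ] ℤ.* + 2) ℤ.* + 1
  even-num = ℤ.solve-∀

  odd-num : ∀ a → + 2 ℤ.* a ℤ.- + 6 ≡ (a ℤ.* + 2 ℤ.+ -[1+ 2 ] ℤ.* + 2) ℤ.* + 1
  odd-num = ℤ.solve-∀

  cancel-4 : ∀ b → + 2 ℤ.* b ℤ.+ + 4 ℤ.- + 4 ≡ b ℤ.* + 2
  cancel-4 = ℤ.solve-∀

  cancel-6 : ∀ b → + 2 ℤ.* (+ 2 ℤ.* b ℤ.+ + 3) ℤ.- + 6 ≡ b ℤ.* + 4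
  cancel-6 = ℤ.solve-∀

  even-lhs : ∀ n → + (3 * n) ℤ.- + 4 ≡ ((+ 3 ℤ.* + n) ℤ.* + 1 ℤ.+ -[1+ 1 ] ℤ.* + 2) ℤ.* + 1
  even-lhs n = trans (cong (ℤ._- + 4) (ℤ.pos-* 3 n)) (even-num (+ 3 ℤ.* + n))

  even-rhs : ∀ m → + (2 * m + 4) ℤ.- + 4 ≡ + m ℤ.* + 2
  even-rhs m = trans (cong (λ x → x ℤ.+ + 4 ℤ.- + 4) (ℤ.pos-* 2 m)) (cancel-4 (+ m))

  odd-lhs : ∀ n → + (2 * (3 * n)) ℤ.- + 6 ≡ ((+ 3 ℤ.* + n) ℤ.* + 2 ℤ.+ -[1+ 2 ] ℤ.* + 2) ℤ.* + 1
  odd-lhs n = trans (cong (ℤ._- + 6) (trans (ℤ.pos-* 2 (3 * n)) (cong (+ 2 ℤ.*_) (ℤ.pos-* 3 n))))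
                    (odd-num (+ 3 ℤ.* + n))

  odd-rhs : ∀ m → + (2 * (2 * m + 3)) ℤ.- + 6 ≡ + m ℤ.* + 4
  odd-rhs m = trans (cong (ℤ._- + 6) (trans (ℤ.pos-* 2 (2 * m + 3))
                (cong (λ x → + 2 ℤ.* (x ℤ.+ + 3)) (ℤ.pos-* 2 m)))) (cancel-6 (+ m))

bound≤ : ∀ n m → 3 * n ≤ 2 * m + slack (parity n) → bound n ≤ℚ (+ m / 1)
bound≤ n m h with parity n
... | 0ℙ = *≤* (shift (+ 4) (even-lhs n) (even-rhs m) h)
-- The subtraction of two halves has denominator `2 * 2`, hence the doubling.
... | 1ℙ = *≤* (shift (+ 6) (odd-lhs n) (odd-rhs m) (*-monoʳ-≤ 2 h))

≤bound : ∀ n m → 2 * m + slack (parity n) ≤ 3 * n → (+ m / 1) ≤ℚ bound n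
≤bound n m h with parity n
... | 0ℙ = *≤* (shift (+ 4) (even-rhs m) (even-lhs n) h)
... | 1ℙ = *≤* (shift (+ 6) (odd-rhs m) (odd-lhs n) (*-monoʳ-≤ 2 h))

-- For odd `n`, `3 * n` is odd while `2 * m + 4` is even, so the inequality is strict.
round-up : ∀ n m → 3 * n ≤ 2 * m + 4 → 3 * n ≤ 2 * m + slack (parity n)
round-up n m h with parity n in eq
... | 0ℙ = h
... | 1ℙ = ≤-pred (subst (3 * n <_) (+-suc (2 * m) 3) (≤∧≢⇒< h odd≢even))
  where
  odd≢even : 3 * n ≢ 2 * m + 4
  odd≢even e with trans (≡-sym (trans (ℙ.*-homo-* 3 n) eq))
                        (trans (cong parity e) (trans (ℙ.+-homo-+ (2 * m) 4)
                          (cong (ℙ._+ 0ℙ) (ℙ.*-homo-* 2 m))))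
  ... | ()

-- The extremal graphs

two-members⇒2≤∣S∣ : ∀ {S : Subset n} {a b} → a ∈ₛ S → b ∈ₛ S → a ≢ b → 2 ≤ ∣ S ∣
two-members⇒2≤∣S∣ a∈ b∈ a≢b =
  ≤-trans (s≤s (≤-trans (s≤s z≤n) (x∈p⇒∣p-x∣<∣p∣ (x∈p∧x≢y⇒x∈p-y a∈ a≢b)))) (x∈p⇒∣p-x∣<∣p∣ b∈)

-- Stands for `∣ S ∣ ≤ 1` in a form that passes to the old vertices without counting.
Subsingleton : Subset n → Set
Subsingleton S = ∀ {a b} → a ∈ₛ S → b ∈ₛ S → a ≡ b

AdjWithout-sym : (G : Graph n) → ∀ {S u v} → AdjWithout G S u v → AdjWithout G S v u
AdjWithout-sym G (u∉S , v∉S , uv) = v∉S , u∉S , sym G uv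

isolated : {G : Graph n} → ∀ {S u v} → (∀ {w} → Adj G u w → w ∈ₛ S) → u ≢ v →
           ¬ Star (AdjWithout G S) u v
isolated nbrs∈S u≢v ε = u≢v refl
isolated nbrs∈S _ ((_ , w∉S , uw) ◅ _) = w∉S (nbrs∈S uw)

-- The invariant of the gluing induction, with `x₀y₀` the edge to glue along. `few` bounds the size
-- from above only; equality comes from the lower bound.
record Extremal (G : Graph n) : Set where
  field
    color    : Fin n → Bool
    proper   : ∀ {u v} → Adj G u v → color u ≢ color v
    x₀ y₀    : Fin n
    x₀y₀     : Adj G x₀ y₀
    robust   : ∀ {S} → Subsingleton S → ∀ {u v} → u ∉ₛ S → v ∉ₛ S → Star (AdjWithout G S) u v
    cut      : ∃ λ S → VertexCut G S × ∣ S ∣ ≡ 2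
    chordal  : ∀ (C : Cycle G) → 6 ≤ len C → ∃ λ u → ∃ λ v → Chord C u v
    few      : 2 * size G + slack (parity n) ≤ 3 * n

module _ {G : Graph n} (ext : Extremal G) where

  open Extremal ext

  -- `cut` serves twice: it excludes completeness and attains the minimum. Smaller sets are
  -- subsingletons, which cannot separate by `robust`.
  extremal-connected : Connected 2 G
  extremal-connected = 2 , inj₂ (incomplete (proj₂ cut) , cut , at-least-2) , ≤-refl
    where
    incomplete : ∀ {S} → VertexCut G S × ∣ S ∣ ≡ 2 → ¬ Complete G
    incomplete ((u , v , u∉S , v∉S , ¬uv) , _) complete with u Fin.≟ v
    ... | yes refl = ¬uv ε
    ... | no u≢v   = ¬uv ((u∉S , v∉S , complete u≢v) ◅ ε)

    at-least-2 : ∀ S → VertexCut G S → 2 ≤ ∣ S ∣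
    at-least-2 S (u , v , u∉S , v∉S , ¬uv) = ≮⇒≥ λ small →
      ¬uv (robust (λ {a} {b} a∈ b∈ → decidable-stable (a Fin.≟ b)
                    λ a≢b → <⇒≱ small (two-members⇒2≤∣S∣ a∈ b∈ a≢b)) u∉S v∉S)

  extremal-chordalBipartite : ChordalBipartite G
  extremal-chordalBipartite = (X , independent , independent-∁) , chordal
    where
    X : Subset n
    X = Vec.tabulate color

    ∈X⇒ : ∀ {u} → u ∈ₛ X → color u ≡ true
    ∈X⇒ {u} u∈ = trans (≡-sym (lookup∘tabulate color u)) ([]=⇒lookup u∈)

    ∈∁X⇒ : ∀ {u} → u ∈ₛ ∁ X → color u ≡ false
    ∈∁X⇒ {u} u∈ = ¬-not λ eq →
      x∈∁p⇒x∉p u∈ (lookup⇒[]= u X (trans (lookup∘tabulate color u) eq))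

    independent : Independent G X
    independent u∈ v∈ uv = proper uv (trans (∈X⇒ u∈) (≡-sym (∈X⇒ v∈)))

    independent-∁ : Independent G (∁ X)
    independent-∁ u∈ v∈ uv = proper uv (trans (∈∁X⇒ u∈) (≡-sym (∈∁X⇒ v∈)))

part : ∀ {m} → Fin (2 + m) → Bool
part zero          = true
part (suc zero)    = true
part (suc (suc _)) = false

-- K₂ m is K₂,ₘ, not the complete graph on two vertices.
K₂ : ∀ m → Graph (2 + m)
K₂ m = record
  { Adj    = λ u v → part u ≢ part v
  ; adj?   = λ u v → ¬? (part u Bool.≟ part v)
  ; sym    = λ uv → uv ∘ ≡-sym
  ; irrefl = λ { refl uu → uu refl }
  }

module _ (m : ℕ) where

  private
    G = K₂ (2 + m)

  two-opposite : ∀ c → ∃ λ u → ∃ λ v → u ≢ v × c ≢ part {2 + m} u × c ≢ part {2 + m} v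
  two-opposite true  = suc (suc zero) , suc (suc (suc zero)) , (λ ()) , (λ ()) , (λ ())
  two-opposite false = zero , suc zero , (λ ()) , (λ ()) , (λ ())

  -- Vertices of one part have two common neighbours, of which at most one is deleted.
  K₂-robust : ∀ {S} → Subsingleton S → ∀ {u v} → u ∉ₛ S → v ∉ₛ S → Star (AdjWithout G S) u v
  K₂-robust {S} sub {u} {v} u∉S v∉S with part u Bool.≟ part v
  ... | no u≢v = (u∉S , v∉S , u≢v) ◅ ε
  ... | yes u≡v with two-opposite (part u)
  ...   | w , w′ , w≢w′ , u≢w , u≢w′ with w ∈ₛ? S
  ...     | no w∉S  = (u∉S , w∉S , u≢w) ◅ (w∉S , v∉S , λ w≡v → u≢w (trans u≡v (≡-sym w≡v))) ◅ ε
  ...     | yes w∈S = (u∉S , w′∉S , u≢w′) ◅ (w′∉S , v∉S , λ w≡v → u≢w′ (trans u≡v (≡-sym w≡v))) ◅ ε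
    where
    w′∉S : w′ ∉ₛ S
    w′∉S w′∈S = w≢w′ (sub w∈S w′∈S)

  K₂-cut : ∃ λ S → VertexCut G S × ∣ S ∣ ≡ 2
  K₂-cut = S
         , ( suc (suc zero) , suc (suc (suc zero))
           , (λ { (there (there x∈)) → ∉⊥ x∈ }) , (λ { (there (there x∈)) → ∉⊥ x∈ })
           , isolated {G = G} hubs (λ ()) )
         , cong (λ z → 2 + z) (∣⊥∣≡0 (2 + m))
    where
    S : Subset (4 + m)
    S = inside Vec.∷ inside Vec.∷ ∅

    hubs : ∀ {w} → false ≢ part w → w ∈ₛ S
    hubs {zero}        _  = here
    hubs {suc zero}    _  = there here
    hubs {suc (suc _)} ne = contradiction refl ne

  -- With fewer than six vertices there is no cycle of length 6 or more, so `chordal` is vacuous.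
  K₂-extremal : 4 + m < 6 → 2 * size G + slack (parity (4 + m)) ≤ 3 * (4 + m) → Extremal G
  K₂-extremal n<6 few = record
    { color = part ; proper = id
    ; x₀ = zero ; y₀ = suc (suc zero) ; x₀y₀ = λ ()
    ; robust = λ {S} → K₂-robust {S} ; cut = K₂-cut
    ; chordal = λ C 6≤ → contradiction (≤-trans 6≤ (Fin.injective⇒≤ (injective C))) (<⇒≱ n<6)
    ; few = few
    }

-- Walking around a cycle

next : ∀ {k} (i : Fin k) → ∃ (Next i)
next {suc k} i with suc (toℕ i) <? suc k
... | yes i<k = fromℕ< i<k , inj₁ (Fin.toℕ-fromℕ< i<k)
... | no i≮k  = zero , inj₂ (≤-antisym (Fin.toℕ<n i) (≮⇒≥ i≮k) , refl)

prev : ∀ {k} (i : Fin k) → ∃ λ h → Next h i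
prev {suc k} zero    = Fin.fromℕ k , inj₂ (cong suc (Fin.toℕ-fromℕ k) , refl)
prev {suc k} (suc i) = Fin.inject₁ i , inj₁ (cong suc (≡-sym (Fin.toℕ-inject₁ i)))

next-unique : ∀ {k} {i j j′ : Fin k} → Next i j → Next i j′ → j ≡ j′
next-unique (inj₁ p) (inj₁ q) = Fin.toℕ-injective (trans p (≡-sym q))
next-unique (inj₂ (_ , p)) (inj₂ (_ , q)) = Fin.toℕ-injective (trans p (≡-sym q))
next-unique {j = j} (inj₁ p) (inj₂ (last , _)) = ⊥-elim (<⇒≢ (Fin.toℕ<n j) (trans p last))
next-unique {j′ = j′} (inj₂ (last , _)) (inj₁ q) = ⊥-elim (<⇒≢ (Fin.toℕ<n j′) (trans q last))

-- The congruence `t + i ≡ j` modulo `k` with explicit quotient: `j` lies `t` steps after `i`.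
record Advance {k} (t : ℕ) (i j : Fin k) : Set where
  constructor advance
  field
    turns    : ℕ
    position : t + toℕ i ≡ turns * k + toℕ j

next⇒advance : ∀ {k} {i j : Fin k} → Next i j → Advance 1 i j
next⇒advance (inj₁ j≡1+i) = advance 0 (≡-sym j≡1+i)
next⇒advance {k} {j = j} (inj₂ (last , j≡0)) = advance 1 (begin
  suc _            ≡⟨ last ⟩
  k                ≡⟨ *-identityˡ k ⟨
  1 * k            ≡⟨ +-identityʳ (1 * k) ⟨
  1 * k + 0        ≡⟨ cong (λ z → 1 * k + z) j≡0 ⟨
  1 * k + toℕ j    ∎)
  where open ≡-Reasoning

infixl 5 _▷_

_▷_ : ∀ {k t} {h i j : Fin k} → Advance t h i → Next i j → Advance (suc t) h j
_▷_ {k} {t} {h} {i} {j} (advance e p) i→j with next⇒advance i→j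
... | advance e′ q = advance (e + e′) (begin
  suc (t + toℕ h)           ≡⟨ cong suc p ⟩
  suc (e * k + toℕ i)       ≡⟨ +-suc (e * k) (toℕ i) ⟨
  e * k + suc (toℕ i)       ≡⟨ cong (λ z → e * k + z) q ⟩
  e * k + (e′ * k + toℕ j)  ≡⟨ +-assoc (e * k) (e′ * k) (toℕ j) ⟨
  e * k + e′ * k + toℕ j    ≡⟨ cong (_+ toℕ j) (*-distribʳ-+ k e e′) ⟨
  (e + e′) * k + toℕ j      ∎)
  where open ≡-Reasoning

-- Cancelling `i` makes `suc t` a positive multiple of `k`.
advance-loop : ∀ {k t} {i : Fin k} → Advance (suc t) i i → k ≤ suc t
advance-loop {k} {t} {i} (advance e p) with e | +-cancelʳ-≡ (toℕ i) (suc t) (e * k) p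
... | suc e | eq = subst (k ≤_) (≡-sym eq) (m≤m+n k (e * k))

no-return₂ : ∀ {k} {i j : Fin k} → 6 ≤ k → Next i j → ¬ Next j i
no-return₂ 6≤k ij ji =
  <⇒≱ (≤-trans (s≤s (s≤s (s≤s z≤n))) 6≤k) (advance-loop (next⇒advance ij ▷ ji))

-- A cycle step from `h` to `k` would force `k ≡ i` and a return after two steps; a step from `k` to
-- `h` would close the cycle after four.
four-path-chord : {G : Graph n} (C : Cycle G) → 6 ≤ len C → ∀ {h i j k} →
                  Next h i → Next i j → Next j k → Adj G (vertex C h) (vertex C k) →
                  Chord C (vertex C h) (vertex C k)
four-path-chord C 6≤k {h} {i} {j} {k} hi ij jk hk = hk , not-edge , (h , refl) , (k , refl)
  where
  not-edge : ¬ CycleEdge C (vertex C h) (vertex C k)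
  not-edge (h′ , k′ , hk′ , eqh , eqk) with injective C eqh | injective C eqk
  not-edge (_ , _ , inj₁ h→k , _) | refl | refl with next-unique hi h→k
  ... | refl = no-return₂ 6≤k ij jk
  not-edge (_ , _ , inj₂ k→h , _) | refl | refl =
    <⇒≱ (≤-trans (s≤s (s≤s (s≤s (s≤s (s≤s z≤n))))) 6≤k)
        (advance-loop (next⇒advance hi ▷ ij ▷ jk ▷ k→h))

-- The 4-cycle x₀ 0 1 y₀ is glued to G along the edge x₀y₀, with 0 and 1 the new vertices.
module Page (G : Graph n) (x₀ y₀ : Fin n) where

  PageAdj : Rel (Fin (2 + n)) 0ℓ
  PageAdj zero          zero          = ⊥
  PageAdj zero          (suc zero)    = ⊤
  PageAdj zero          (suc (suc y)) = y ≡ x₀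
  PageAdj (suc zero)    zero          = ⊤
  PageAdj (suc zero)    (suc zero)    = ⊥
  PageAdj (suc zero)    (suc (suc y)) = y ≡ y₀
  PageAdj (suc (suc x)) zero          = x ≡ x₀
  PageAdj (suc (suc x)) (suc zero)    = x ≡ y₀
  PageAdj (suc (suc x)) (suc (suc y)) = Adj G x y

  page-adj? : ∀ u v → Dec (PageAdj u v)
  page-adj? zero          zero          = no λ ()
  page-adj? zero          (suc zero)    = yes tt
  page-adj? zero          (suc (suc y)) = y Fin.≟ x₀
  page-adj? (suc zero)    zero          = yes tt
  page-adj? (suc zero)    (suc zero)    = no λ ()
  page-adj? (suc zero)    (suc (suc y)) = y Fin.≟ y₀
  page-adj? (suc (suc x)) zero          = x Fin.≟ x₀
  page-adj? (suc (suc x)) (suc zero)    = x Fin.≟ y₀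
  page-adj? (suc (suc x)) (suc (suc y)) = adj? G x y

  page-sym : ∀ u v → PageAdj u v → PageAdj v u
  page-sym zero          (suc zero)    uv = uv
  page-sym zero          (suc (suc y)) uv = uv
  page-sym (suc zero)    zero          uv = uv
  page-sym (suc zero)    (suc (suc y)) uv = uv
  page-sym (suc (suc x)) zero          uv = uv
  page-sym (suc (suc x)) (suc zero)    uv = uv
  page-sym (suc (suc x)) (suc (suc y)) uv = sym G uv

  page-irrefl : ∀ u → ¬ PageAdj u u
  page-irrefl (suc (suc x)) uu = irrefl G refl uu

  addPage : Graph (2 + n)
  addPage = record
    { Adj = PageAdj ; adj? = page-adj?
    ; sym = λ {u} {v} → page-sym u v ; irrefl = λ { {u} refl → page-irrefl u }
    }

-- Gluing a 4-cycle preserves extremality.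

module _ {G : Graph n} (ext : Extremal G) where

  open Extremal ext
  open Page G x₀ y₀

  private
    G⁺ : Graph (2 + n)
    G⁺ = addPage

    ⟨_⟩ : Fin n → Fin (2 + n)
    ⟨ x ⟩ = suc (suc x)

    0# 1# : Fin (2 + n)
    0# = zero
    1# = suc zero

    nbr₀ : ∀ {w} → PageAdj 0# w → (w ≡ 1#) ⊎ (w ≡ ⟨ x₀ ⟩)
    nbr₀ {suc zero}    _    = inj₁ refl
    nbr₀ {suc (suc _)} refl = inj₂ refl

    nbr₁ : ∀ {w} → PageAdj 1# w → (w ≡ 0#) ⊎ (w ≡ ⟨ y₀ ⟩)
    nbr₁ {zero}        _    = inj₁ refl
    nbr₁ {suc (suc _)} refl = inj₂ refl

  -- Opposite vertices of the 4-cycle `x₀ 0 1 y₀` get equal colours.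
  page-color : Fin (2 + n) → Bool
  page-color zero          = color y₀
  page-color (suc zero)    = color x₀
  page-color (suc (suc x)) = color x

  page-proper : ∀ u v → PageAdj u v → page-color u ≢ page-color v
  page-proper zero          (suc zero)    _    = proper x₀y₀ ∘ ≡-sym
  page-proper zero          (suc (suc _)) refl = proper x₀y₀ ∘ ≡-sym
  page-proper (suc zero)    zero          _    = proper x₀y₀
  page-proper (suc zero)    (suc (suc _)) refl = proper x₀y₀
  page-proper (suc (suc _)) zero          refl = proper x₀y₀
  page-proper (suc (suc _)) (suc zero)    refl = proper x₀y₀ ∘ ≡-sym
  page-proper (suc (suc _)) (suc (suc _)) uv   = proper uv

  -- Every surviving vertex reaches a surviving old one, and these are joined by `robust`. A new
  -- vertex whose old neighbour is deleted goes through the other new vertex.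
  page-robust : ∀ {S} → Subsingleton S → ∀ {u v} → u ∉ₛ S → v ∉ₛ S → Star (AdjWithout G⁺ S) u v
  page-robust {s Vec.∷ t Vec.∷ S} sub {u} {v} u∉ v∉ =
    let (a , a∉ , ua) = anchor u u∉
        (b , b∉ , vb) = anchor v v∉
    in ua ◅◅ lift (robust sub′ a∉ b∉) ◅◅ reverse (AdjWithout-sym G⁺) vb
    where
    S⁺ : Subset (2 + n)
    S⁺ = s Vec.∷ t Vec.∷ S

    sub′ : Subsingleton S
    sub′ a∈ b∈ with sub (there (there a∈)) (there (there b∈))
    ... | refl = refl

    lift∉ : ∀ {x} → x ∉ₛ S → ⟨ x ⟩ ∉ₛ S⁺
    lift∉ x∉ (there (there x∈)) = x∉ x∈

    y₀∉ : x₀ ∈ₛ S → y₀ ∉ₛ S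
    y₀∉ x₀∈ y₀∈ = irrefl G (sub′ x₀∈ y₀∈) x₀y₀

    lift : ∀ {x y} → Star (AdjWithout G S) x y → Star (AdjWithout G⁺ S⁺) ⟨ x ⟩ ⟨ y ⟩
    lift = Star.gmap ⟨_⟩ λ { (x∉ , y∉ , xy) → lift∉ x∉ , lift∉ y∉ , xy }

    anchor : ∀ z → z ∉ₛ S⁺ → ∃ λ o → o ∉ₛ S × Star (AdjWithout G⁺ S⁺) z ⟨ o ⟩
    anchor (suc (suc o)) z∉ = o , (λ o∈ → z∉ (there (there o∈))) , ε
    anchor zero z∉ with x₀ ∈ₛ? S
    ... | no x₀∉  = x₀ , x₀∉ , (z∉ , lift∉ x₀∉ , refl) ◅ ε
    ... | yes x₀∈ = y₀ , y₀∉ x₀∈ , (z∉ , 1∉ , tt) ◅ (1∉ , lift∉ (y₀∉ x₀∈) , refl) ◅ ε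
      where
      1∉ : 1# ∉ₛ S⁺
      1∉ 1∈ with sub 1∈ (there (there x₀∈))
      ... | ()
    anchor (suc zero) z∉ with x₀ ∈ₛ? S
    ... | yes x₀∈ = y₀ , y₀∉ x₀∈ , (z∉ , lift∉ (y₀∉ x₀∈) , refl) ◅ ε
    ... | no x₀∉ with y₀ ∈ₛ? S
    ...   | no y₀∉S = y₀ , y₀∉S , (z∉ , lift∉ y₀∉S , refl) ◅ ε
    ...   | yes y₀∈ = x₀ , x₀∉ , (z∉ , 0∉ , tt) ◅ (0∉ , lift∉ x₀∉ , refl) ◅ ε
      where
      0∉ : 0# ∉ₛ S⁺
      0∉ 0∈ with sub 0∈ (there (there y₀∈))
      ... | ()

  page-cut : ∃ λ S → VertexCut G⁺ S × ∣ S ∣ ≡ 2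
  page-cut = S , (0# , ⟨ y₀ ⟩ , (λ ()) , y₀∉ , isolated {G = G⁺} nbrs∈S (λ ()))
               , cong suc (∣⁅x⁆∣≡1 x₀)
    where
    S : Subset (2 + n)
    -- The two neighbours of `0#`: the vertex `1#` and `⟨ x₀ ⟩`.
    S = outside Vec.∷ inside Vec.∷ ⁅ x₀ ⁆

    y₀∉ : ⟨ y₀ ⟩ ∉ₛ S
    y₀∉ (there (there y₀∈)) = irrefl G (≡-sym (x∈⁅y⁆⇒x≡y x₀ y₀∈)) x₀y₀

    nbrs∈S : ∀ {w} → PageAdj 0# w → w ∈ₛ S
    nbrs∈S {w} 0w with nbr₀ {w} 0w
    ... | inj₁ refl = there here
    ... | inj₂ refl = there (there (x∈⁅x⁆ x₀))

  page-size : size G⁺ ≤ 3 + size G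
  page-size = subst (size G⁺ ≤_) (cong (λ z → 3 + z) (length-map lift (edges G)))
                    (unique-⊆⇒length≤ (edges-unique G⁺) (λ {e} e∈ → cover e (∈-edges⁻ G⁺ e∈)))
    where
    lift : Fin n × Fin n → Fin (2 + n) × Fin (2 + n)
    lift (x , y) = ⟨ x ⟩ , ⟨ y ⟩

    cover : ∀ ((u , v) : Fin (2 + n) × Fin (2 + n)) → u Fin.< v × PageAdj u v →
            (u , v) ∈ (0# , 1#) ∷ (0# , ⟨ x₀ ⟩) ∷ (1# , ⟨ y₀ ⟩) ∷ map lift (edges G)
    cover (zero        , suc zero)    _          = here refl
    cover (zero        , suc (suc _)) (_ , refl) = there (here refl)
    cover (suc zero    , suc (suc _)) (_ , refl) = there (there (here refl))
    cover (suc (suc _) , suc zero)    (s≤s () , _)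
    cover (suc (suc _) , suc (suc _)) (s≤s (s≤s x<y) , xy) =
      there (there (there (∈-map⁺ lift (∈-edges⁺ G x<y xy))))

  module PageChord (C : Cycle G⁺) (6≤k : 6 ≤ len C) where

    private
      f = vertex C

    HasChord : Set
    HasChord = ∃ λ u → ∃ λ v → Chord C u v

    adj : ∀ {i j} → Next i j → ∀ {u v} → f i ≡ u → f j ≡ v → PageAdj u v
    adj ij refl refl = adjacent C ij

    adj⁻ : ∀ {i j} → Next i j → ∀ {v} → f j ≡ v → PageAdj v (f i)
    adj⁻ {i} {j} ij refl = page-sym (f i) (f j) (adjacent C ij)

    same : ∀ {i j u} → f i ≡ u → f j ≡ u → i ≡ j
    same p q = injective C (trans p (≡-sym q))

    not-both : ∀ {h i j u} → Next h i → Next i j → f h ≡ u → f j ≢ u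
    not-both hi ij p q with same p q
    ... | refl = no-return₂ 6≤k hi ij

    chord : ∀ {h i j k} → Next h i → Next i j → Next j k → PageAdj (f h) (f k) → HasChord
    chord hi ij jk hk = _ , _ , four-path-chord C 6≤k hi ij jk hk

    -- The cycle neighbours of `0#` are distinct, hence `1#` and `⟨ x₀ ⟩`; beyond `1#` lies
    -- `⟨ y₀ ⟩`, which `x₀y₀` joins to `⟨ x₀ ⟩`.
    through-0 : ∀ {i} → f i ≡ 0# → HasChord
    through-0 {i} i0 with prev i | next i
    ... | h , hi | j , ij
      with nbr₀ {f h} (adj⁻ hi i0) | nbr₀ {f j} (adj ij i0 refl)
    ... | inj₁ h1 | inj₁ j1 = ⊥-elim (not-both hi ij h1 j1)
    ... | inj₂ hx | inj₂ jx = ⊥-elim (not-both hi ij hx jx)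
    ... | inj₂ hx | inj₁ j1 with next j
    ...   | k , jk with nbr₁ {f k} (adj jk j1 refl)
    ...     | inj₁ k0 = ⊥-elim (not-both ij jk i0 k0)
    ...     | inj₂ ky = chord hi ij jk (subst₂ PageAdj (≡-sym hx) (≡-sym ky) x₀y₀)
    -- The same path, traversed from `⟨ y₀ ⟩` to `⟨ x₀ ⟩`.
    through-0 {i} i0 | h , hi | j , ij | inj₁ h1 | inj₂ jx with prev h
    ...   | g , gh with nbr₁ {f g} (adj⁻ gh h1)
    ...     | inj₁ g0 = ⊥-elim (not-both gh hi g0 i0)
    ...     | inj₂ gy = chord gh hi ij (subst₂ PageAdj (≡-sym gy) (≡-sym jx) (sym G x₀y₀))

    through-1 : ∀ {i} → f i ≡ 1# → HasChord
    through-1 {i} i1 with prev i | next i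
    ... | h , hi | j , ij
      with nbr₁ {f h} (adj⁻ hi i1) | nbr₁ {f j} (adj ij i1 refl)
    ... | inj₁ h0 | _       = through-0 h0
    ... | inj₂ _  | inj₁ j0 = through-0 j0
    ... | inj₂ hy | inj₂ jy = ⊥-elim (not-both hi ij hy jy)

    -- On old vertices `PageAdj` is `Adj G` by definition, so the cycle descends to `G` and its
    -- chord lifts back.
    avoiding : (∀ i → f i ≢ 0#) → (∀ i → f i ≢ 1#) → HasChord
    avoiding ≢0 ≢1 = lift (chordal D 6≤k)
      where
      old : ∀ w → w ≢ 0# → w ≢ 1# → ∃ λ x → ⟨ x ⟩ ≡ w
      old zero          w≢0 _   = contradiction refl w≢0
      old (suc zero)    _   w≢1 = contradiction refl w≢1
      old (suc (suc x)) _   _   = x , refl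

      g : Fin (len C) → Fin n
      g i = proj₁ (old (f i) (≢0 i) (≢1 i))

      g-lift : ∀ i → ⟨ g i ⟩ ≡ f i
      g-lift i = proj₂ (old (f i) (≢0 i) (≢1 i))

      D : Cycle G
      D = record
        { len = len C ; 3≤len = 3≤len C ; vertex = g
        ; injective = λ {i} {j} eq →
            injective C (trans (≡-sym (g-lift i)) (trans (cong ⟨_⟩ eq) (g-lift j)))
        ; adjacent = λ {i} {j} ij → adj ij (≡-sym (g-lift i)) (≡-sym (g-lift j))
        }

      lift : (∃ λ u → ∃ λ v → Chord D u v) → HasChord
      lift (u , v , uv , not-edge , (i , iu) , (j , jv)) =
        ⟨ u ⟩ , ⟨ v ⟩ , uv
        , (λ { (a , b , ab , au , bv) → not-edge
                 (a , b , ab , lower a au , lower b bv) })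
        , (i , trans (≡-sym (g-lift i)) (cong ⟨_⟩ iu))
        , (j , trans (≡-sym (g-lift j)) (cong ⟨_⟩ jv))
        where
        lower : ∀ a {x} → f a ≡ ⟨ x ⟩ → g a ≡ x
        lower a eq = Fin.suc-injective (Fin.suc-injective (trans (g-lift a) eq))

    page-chord : HasChord
    page-chord with Fin.any? (λ i → f i Fin.≟ 0#) | Fin.any? (λ i → f i Fin.≟ 1#)
    ... | yes (_ , i0) | _            = through-0 i0
    ... | no _         | yes (_ , i1) = through-1 i1
    ... | no ≢0        | no ≢1        = avoiding (λ i eq → ≢0 (i , eq)) (λ i eq → ≢1 (i , eq))

  page-extremal : Extremal G⁺
  page-extremal = record
    { color = page-color ; proper = λ {u} {v} → page-proper u v
    ; x₀ = ⟨ x₀ ⟩ ; y₀ = ⟨ y₀ ⟩ ; x₀y₀ = x₀y₀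
    ; robust = page-robust ; cut = page-cut ; chordal = PageChord.page-chord ; few = few⁺
    }
    where
    -- `parity (2 + n)` computes to `parity n`, so the slack is unchanged.
    few⁺ : 2 * size G⁺ + slack (parity n) ≤ 3 * (2 + n)
    few⁺ = begin
      2 * size G⁺ + slack (parity n)       ≤⟨ +-monoˡ-≤ (slack (parity n)) (*-monoʳ-≤ 2 page-size) ⟩
      2 * (3 + size G) + slack (parity n)  ≡⟨ cong (_+ slack (parity n)) (*-distribˡ-+ 2 3 (size G)) ⟩
      6 + (2 * size G + slack (parity n))  ≤⟨ +-monoʳ-≤ 6 few ⟩
      6 + 3 * n                            ≡⟨ *-distribˡ-+ 3 2 n ⟨
      3 * (2 + n)                          ∎
      where open ≤-Reasoning

-- One base case per parity. K₂,₂ has 4 edges and K₂,₃ has 6, so `few` reads `12 ≤ 12` and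
-- `15 ≤ 15`.
extremal-graph : ∀ n → ∃ λ (G : Graph (4 + n)) → Extremal G
extremal-graph 0 = K₂ 2 , K₂-extremal 0 (n≤1+n 5) ≤-refl
extremal-graph 1 = K₂ 3 , K₂-extremal 1 ≤-refl ≤-refl
extremal-graph (suc (suc n)) with extremal-graph n
... | G , ext = _ , page-extremal ext

theorem1p1 : (∀ n (G : Graph n) → 4 ≤ n → Connected 2 G → ChordalBipartite G →
    bound n ≤ℚ (+ size G / 1))
    × (∀ n → 4 ≤ n →
    ∃ λ (G : Graph n) → Connected 2 G × ChordalBipartite G × (+ size G / 1) ≃ bound n)
theorem1p1 = lower , tight
  where
  lower : ∀ n (G : Graph n) → 4 ≤ n → Connected 2 G → ChordalBipartite G →
          bound n ≤ℚ (+ size G / 1)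
  lower n G 4≤n conn cb = bound≤ n (size G)
    (round-up n (size G) (LowerBound.size-bound G conn cb 4≤n))

  tight : ∀ n → 4 ≤ n →
          ∃ λ (G : Graph n) → Connected 2 G × ChordalBipartite G × (+ size G / 1) ≃ bound n
  tight n 4≤n with m≤n⇒∃[o]m+o≡n 4≤n
  ... | k , refl with extremal-graph k
  ...   | G , ext = G , extremal-connected ext , extremal-chordalBipartite ext
    -- The lower bound, applied to the extremal graph itself, turns `few` into an equality.
    , ℚ.≤-antisym (≤bound n (size G) (Extremal.few ext))
                  (lower n G 4≤n (extremal-connected ext) (extremal-chordalBipartite ext))
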